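{- Let $\Sigma,\Sigma'$ be disjoint signatures and let $\mathcal{U},\mathcal{U}'$ be basic quantitative equational theories of type $\Sigma$ and $\Sigma'$ respectively. Then the monad $T_{\mathcal{U}+\mathcal{U}'}$ on $\mathbf{Met}$ is isomorphic to the sum $T_{\mathcal{U}}+T_{\mathcal{U}'}$, i.e. to the coproduct of $T_{\mathcal{U}}$ and $T_{\mathcal{U}'}$ in the category of monads on $\mathbf{Met}$ and monad maps.
   Context: An extended metric space is a set $X$ with $d_X:X\times X\to[0,\infty]$ satisfying $d_X(x,y)=0$ iff $x=y$, symmetry and the triangle inequality. $\mathbf{Met}$ is the category of extended metric spaces and non-expansive maps. Quantitative theories. A signature $\Sigma$ is a set of function symbols $f:n$ of finite arity $n\in\mathbb{N}$. Fix a countably infinite set of variables $V$; terms are $\Sigma$-terms over $V$. A quantitative equation is an expression $t=_\varepsilon s$ with $t,s$ terms and $\varepsilon\in\mathbb{Q}_{\ge0}$. A conditional quantitative equation is $\Gamma\vdash t=_\varepsilon s$ with $\Gamma$ a finite set of quantitative equations. A quantitative equational theory of type $\Sigma$ is a set $\mathcal{U}$ of conditional quantitative equations containing (for all variables and rationals $\varepsilon,\varepsilon'\ge 0$) $\vdash x=_0x$; $\{x=_\varepsilon y\}\vdash y=_\varepsilon x$; $\{x=_\varepsilon z,z=_{\varepsilon'}y\}\vdash x=_{\varepsilon+\varepsilon'}y$; $\{x=_\varepsilon y\}\vdash x=_{\varepsilon+\varepsilon'}y$ for $\varepsilon'>0$; $\{x_i=_\varepsilon y_i\mid i=1,\dots,n\}\vdash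 f(x_1,\dots,x_n)=_\varepsilon f(y_1,\dots,y_n)$ for $f:n\in\Sigma$; and closed under: continuity (if $\Gamma\vdash t=_{\varepsilon'}s\in\mathcal{U}$ for all $\varepsilon'>\varepsilon$ then $\Gamma\vdash t=_\varepsilon s\in\mathcal{U}$), substitution of terms for variables, assumption ($\Gamma\vdash\phi\in\mathcal{U}$ whenever $\phi\in\Gamma$), and cut (if $\Gamma\vdash\phi\in\mathcal{U}$ for all $\phi\in\Theta$ and $\Theta\vdash\psi\in\mathcal{U}$ then $\Gamma\vdash\psi\in\mathcal{U}$). A set $A$ of conditional quantitative equations axiomatizes $\mathcal{U}$ if $\mathcal{U}$ is the smallest theory containing $A$. $\mathcal{U}$ is basic if it is axiomatized by a set of conditional quantitative equations of the form $\{x_1=_{\varepsilon_1}y_1,\dots,x_n=_{\varepsilon_n}y_n\}\vdash t=_\varepsilon s$ with all $x_i,y_i$ variables. Models. A quantitative $\Sigma$-algebra is an extended metric space $A$ with, for each $f:n\in\Sigma$, a map $f^A:A^n\to A$ that is non-expansive for the max metric on $A^n$. It satisfies $\Gamma\vdash t=_\varepsilon s$ if for every assignment $\iota:V\to A$ (extended homomorphically to terms), $d_A(\iota(t'),\iota(s'))\le\varepsilon'$ for all $t'=_{\varepsilon'}s'\in\Gamma$ implies $d_A(\iota(t),\iota(s))\le\varepsilon$. $\mathbb{K}(\Sigma,\mathcal{U})$ is the category of quantitative $\Sigma$-algebras satisfying all members of $\mathcal{U}$, with non-expansive $\Sigma$-homomorphisms. The forgetful functor $\mathbb{K}(\Sigma,\mathcal{U})\to\mathbf{Met}$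 has a left adjoint (known result); $T_{\mathcal{U}}$ denotes the induced monad on $\mathbf{Met}$, called the free monad on $\mathcal{U}$. Sum. For $\mathcal{U},\mathcal{U}'$ of types $\Sigma,\Sigma'$ (disjoint), $\mathcal{U}+\mathcal{U}'$ is the smallest quantitative equational theory of type $\Sigma\cup\Sigma'$ containing $\mathcal{U}$ and $\mathcal{U}'$. A monad map $(T,\eta,\mu)\to(H,\rho,\nu)$ is a natural transformation $\sigma:T\Rightarrow H$ compatible with units and multiplications. -}

module Defs where

open import Level using (Level; _⊔_; Lift; lift; lower) renaming (suc to lsuc)
open import Data.Nat.Base using (ℕ)
open import Data.Product.Base using (∃; ∃₂; _×_; _,_; proj₁; proj₂)
open import Data.Sum.Base using (_⊎_; inj₁; inj₂; [_,_]′)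
open import Data.List.Base as List using (List; []; _∷_)
open import Data.List.Membership.Propositional using () renaming (_∈_ to _∈ˡ_)
open import Data.List.Relation.Unary.All using (All)
open import Data.Vec.Functional using (Vector)
open import Data.Rational.Base as ℚ using (ℚ; 0ℚ)
import Data.Rational.Properties as ℚₚ
open import Function.Metric.Structures using (IsGeneralMetric)
open import Relation.Binary.Structures using (IsEquivalence; IsPartialOrder)
import Relation.Binary.PropositionalEquality.Core as ≡
open import Relation.Unary using (Pred; _∈_; _≐_; _⊆_)

-- Hom-sets are setoids, since there are no quotient types.
record Category (o m e : Level) : Set (lsuc (o ⊔ m ⊔ e)) where
  infix  4 _⇒_ _≈_
  infixr 9 _∘_
  field
    Obj      : Set o
    _⇒_      : Obj → Obj → Set m
    _≈_      : ∀ {A B} → A ⇒ B → A ⇒ B → Set e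
    id       : ∀ {A} → A ⇒ A
    _∘_      : ∀ {A B C} → B ⇒ C → A ⇒ B → A ⇒ C
    equiv    : ∀ {A B} → IsEquivalence (_≈_ {A} {B})
    ∘-resp-≈ : ∀ {A B C} {f h : B ⇒ C} {g i : A ⇒ B} →
               f ≈ h → g ≈ i → f ∘ g ≈ h ∘ i
    assoc    : ∀ {A B C D} {f : A ⇒ B} {g : B ⇒ C} {h : C ⇒ D} →
               (h ∘ g) ∘ f ≈ h ∘ (g ∘ f)
    idˡ      : ∀ {A B} {f : A ⇒ B} → id ∘ f ≈ f
    idʳ      : ∀ {A B} {f : A ⇒ B} → f ∘ id ≈ f

  module Equiv {A B : Obj} = IsEquivalence (equiv {A} {B})

  infixr 5 _○_
  _○_ : ∀ {A B} {f g h : A ⇒ B} → f ≈ g → g ≈ h → f ≈ h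
  _○_ = Equiv.trans

  ∘-resp-≈ˡ : ∀ {A B C} {f h : B ⇒ C} {g : A ⇒ B} → f ≈ h → f ∘ g ≈ h ∘ g
  ∘-resp-≈ˡ p = ∘-resp-≈ p Equiv.refl

  ∘-resp-≈ʳ : ∀ {A B C} {f : B ⇒ C} {g i : A ⇒ B} → g ≈ i → f ∘ g ≈ f ∘ i
  ∘-resp-≈ʳ p = ∘-resp-≈ Equiv.refl p

record Functor {o m e o′ m′ e′} (C : Category o m e) (D : Category o′ m′ e′) :
               Set (o ⊔ m ⊔ e ⊔ o′ ⊔ m′ ⊔ e′) where
  private
    module C = Category C
    module D = Category D
  field
    F₀           : C.Obj → D.Obj
    F₁           : ∀ {A B} → A C.⇒ B → F₀ A D.⇒ F₀ B
    identity     : ∀ {A} → F₁ (C.id {A}) D.≈ D.id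
    homomorphism : ∀ {X Y Z} {f : X C.⇒ Y} {g : Y C.⇒ Z} →
                   F₁ (g C.∘ f) D.≈ F₁ g D.∘ F₁ f
    F-resp-≈     : ∀ {A B} {f g : A C.⇒ B} → f C.≈ g → F₁ f D.≈ F₁ g

idF : ∀ {o m e} {C : Category o m e} → Functor C C
idF {C = C} = record
  { F₀           = λ X → X
  ; F₁           = λ f → f
  ; identity     = Equiv.refl
  ; homomorphism = Equiv.refl
  ; F-resp-≈     = λ p → p
  }
  where open Category C

infixr 9 _∘F_
_∘F_ : ∀ {o m e o′ m′ e′ o″ m″ e″} {C : Category o m e} {D : Category o′ m′ e′}
       {E : Category o″ m″ e″} → Functor D E → Functor C D → Functor C E
_∘F_ {E = E} G F = record
  { F₀           = λ X → G.F₀ (F.F₀ X)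
  ; F₁           = λ f → G.F₁ (F.F₁ f)
  ; identity     = G.F-resp-≈ F.identity ○ G.identity
  ; homomorphism = G.F-resp-≈ F.homomorphism ○ G.homomorphism
  ; F-resp-≈     = λ p → G.F-resp-≈ (F.F-resp-≈ p)
  }
  where
  module F = Functor F
  module G = Functor G
  open Category E

record NaturalTransformation {o m e o′ m′ e′}
         {C : Category o m e} {D : Category o′ m′ e′} (F G : Functor C D) :
         Set (o ⊔ m ⊔ e ⊔ o′ ⊔ m′ ⊔ e′) where
  private
    module C = Category C
    module D = Category D
    module F = Functor F
    module G = Functor G
  field
    η       : ∀ X → F.F₀ X D.⇒ G.F₀ X
    commute : ∀ {X Y} (f : X C.⇒ Y) → η Y D.∘ F.F₁ f D.≈ G.F₁ f D.∘ η X

record Adjunction {o m e o′ m′ e′} {C : Category o m e} {D : Category o′ m′ e′}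
         (L : Functor C D) (R : Functor D C) :
         Set (o ⊔ m ⊔ e ⊔ o′ ⊔ m′ ⊔ e′) where
  private
    module C = Category C
    module D = Category D
  module L = Functor L
  module R = Functor R
  field
    unit   : NaturalTransformation idF (R ∘F L)
    counit : NaturalTransformation (L ∘F R) idF
  module unit   = NaturalTransformation unit
  module counit = NaturalTransformation counit
  field
    zig : ∀ {A} → counit.η (L.F₀ A) D.∘ L.F₁ (unit.η A) D.≈ D.id
    zag : ∀ {B} → R.F₁ (counit.η B) C.∘ unit.η (R.F₀ B) C.≈ C.id

record Monad {o m e} (C : Category o m e) : Set (o ⊔ m ⊔ e) where
  open Category C
  field
    F : Functor C C
    η : NaturalTransformation idF F
    μ : NaturalTransformation (F ∘F F) F
  module F = Functor F
  module η = NaturalTransformation η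
  module μ = NaturalTransformation μ
  field
    μ-assoc : ∀ {X} → μ.η X ∘ F.F₁ (μ.η X) ≈ μ.η X ∘ μ.η (F.F₀ X)
    μ-idˡ   : ∀ {X} → μ.η X ∘ F.F₁ (η.η X) ≈ id
    μ-idʳ   : ∀ {X} → μ.η X ∘ η.η (F.F₀ X) ≈ id

adjunction⇒monad : ∀ {o m e o′ m′ e′} {C : Category o m e} {D : Category o′ m′ e′}
                   {L : Functor C D} {R : Functor D C} → Adjunction L R → Monad C
adjunction⇒monad {C = C} {D} {L} {R} adj = record
  { F       = R ∘F L
  ; η       = unit
  ; μ       = record
    { η       = λ X → R.F₁ (counit.η (L.F₀ X))
    ; commute = λ f → Equiv.sym R.homomorphism ○
                      R.F-resp-≈ (counit.commute (L.F₁ f)) ○ R.homomorphism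
    }
  ; μ-assoc = λ {X} → Equiv.sym R.homomorphism ○
                      R.F-resp-≈ (counit.commute (counit.η (L.F₀ X))) ○
                      R.homomorphism
  ; μ-idˡ   = Equiv.sym R.homomorphism ○ R.F-resp-≈ zig ○ R.identity
  ; μ-idʳ   = zag
  }
  where
  open Adjunction adj
  open Category C
  module D = Category D

record MonadMap {o m e} {C : Category o m e} (T H : Monad C) : Set (o ⊔ m ⊔ e) where
  open Category C
  private
    module T = Monad T
    module H = Monad H
  field
    σ : NaturalTransformation T.F H.F
  module σ = NaturalTransformation σ
  field
    unit-comp : ∀ {X} → σ.η X ∘ T.η.η X ≈ H.η.η X
    mult-comp : ∀ {X} → σ.η X ∘ T.μ.η X ≈ H.μ.η X ∘ (H.F.F₁ (σ.η X) ∘ σ.η (T.F.F₀ X))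

Monads : ∀ {o m e} → Category o m e → Category (o ⊔ m ⊔ e) (o ⊔ m ⊔ e) (o ⊔ e)
Monads C = record
  { Obj      = Monad C
  ; _⇒_      = MonadMap
  ; _≈_      = λ α β → ∀ X → MonadMap.σ.η α X ≈ MonadMap.σ.η β X
  ; id       = λ {T} → let module T = Monad T in record
    { σ         = record
      { η       = λ X → id
      ; commute = λ f → idˡ ○ Equiv.sym idʳ
      }
    ; unit-comp = idˡ
    ; mult-comp = idˡ ○ Equiv.sym
                  (∘-resp-≈ʳ (∘-resp-≈ˡ T.F.identity ○ idˡ) ○ idʳ)
    }
  ; _∘_      = compose
  ; equiv    = record
    { refl  = λ X → Equiv.refl
    ; sym   = λ p X → Equiv.sym (p X)
    ; trans = λ p q X → p X ○ q X
    }
  ; ∘-resp-≈ = λ p q X → ∘-resp-≈ (p X) (q X)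
  ; assoc    = λ X → assoc
  ; idˡ      = λ X → idˡ
  ; idʳ      = λ X → idʳ
  }
  where
  open Category C
  compose : ∀ {T H K : Monad C} → MonadMap H K → MonadMap T H → MonadMap T K
  compose {T} {H} {K} β α = record
    { σ         = record
      { η       = λ X → β.σ.η X ∘ α.σ.η X
      ; commute = λ f → assoc ○ ∘-resp-≈ʳ (α.σ.commute f) ○ Equiv.sym assoc ○
                        ∘-resp-≈ˡ (β.σ.commute f) ○ assoc
      }
    ; unit-comp = assoc ○ ∘-resp-≈ʳ α.unit-comp ○ β.unit-comp
    ; mult-comp = λ {X} →
        assoc ○ ∘-resp-≈ʳ α.mult-comp ○ Equiv.sym assoc ○
        ∘-resp-≈ˡ β.mult-comp ○ assoc ○
        ∘-resp-≈ʳ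
          ( assoc
          ○ ∘-resp-≈ʳ (Equiv.sym assoc ○ ∘-resp-≈ˡ (β.σ.commute (α.σ.η X)) ○ assoc)
          ○ Equiv.sym assoc
          ○ ∘-resp-≈ˡ (Equiv.sym K.F.homomorphism))
    }
    where
    module α = MonadMap α
    module β = MonadMap β
    module K = Monad K

record Coproduct {o m e} (C : Category o m e) (A B : Category.Obj C) :
                 Set (o ⊔ m ⊔ e) where
  open Category C
  field
    object  : Obj
    i₁      : A ⇒ object
    i₂      : B ⇒ object
    [_,_]   : ∀ {X} → A ⇒ X → B ⇒ X → object ⇒ X
    inject₁ : ∀ {X} {f : A ⇒ X} {g : B ⇒ X} → [ f , g ] ∘ i₁ ≈ f
    inject₂ : ∀ {X} {f : A ⇒ X} {g : B ⇒ X} → [ f , g ] ∘ i₂ ≈ g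
    unique  : ∀ {X} {f : A ⇒ X} {g : B ⇒ X} {h : object ⇒ X} →
              h ∘ i₁ ≈ f → h ∘ i₂ ≈ g → [ f , g ] ≈ h

record Iso {o m e} (C : Category o m e) (A B : Category.Obj C) : Set (m ⊔ e) where
  open Category C
  field
    to   : A ⇒ B
    from : B ⇒ A
    isoˡ : from ∘ to ≈ id
    isoʳ : to ∘ from ≈ id

-- A left adjoint presented by a universal arrow X → R (L₀ X) for every X.
record UniversalArrows {o m e o′ m′ e′} {C : Category o m e} {D : Category o′ m′ e′}
         (R : Functor D C) : Set (o ⊔ m ⊔ e ⊔ o′ ⊔ m′ ⊔ e′) where
  private
    module C = Category C
    module D = Category D
    module R = Functor R
  field
    L₀         : C.Obj → D.Obj
    ι          : ∀ X → X C.⇒ R.F₀ (L₀ X)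
    ext        : ∀ {X B} → X C.⇒ R.F₀ B → L₀ X D.⇒ B
    ext-β      : ∀ {X B} (f : X C.⇒ R.F₀ B) → R.F₁ (ext f) C.∘ ι X C.≈ f
    ext-unique : ∀ {X B} {g h : L₀ X D.⇒ B} →
                 R.F₁ g C.∘ ι X C.≈ R.F₁ h C.∘ ι X → g D.≈ h

  open Category C using (_○_; ∘-resp-≈ˡ; ∘-resp-≈ʳ)

  private
    sym : ∀ {A B} {f g : A C.⇒ B} → f C.≈ g → g C.≈ f
    sym = C.Equiv.sym

    R-β : ∀ {X B B′} (g : B D.⇒ B′) (f : X C.⇒ R.F₀ B) →
          R.F₁ (g D.∘ ext f) C.∘ ι X C.≈ R.F₁ g C.∘ f
    R-β g f = ∘-resp-≈ˡ R.homomorphism ○ C.assoc ○ ∘-resp-≈ʳ (ext-β f)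

    R-id : ∀ {X} → R.F₁ (D.id {L₀ X}) C.∘ ι X C.≈ ι X
    R-id = ∘-resp-≈ˡ R.identity ○ C.idˡ

  L : Functor C D
  L = record
    { F₀           = L₀
    ; F₁           = λ f → ext (ι _ C.∘ f)
    ; identity     = ext-unique (ext-β _ ○ C.idʳ ○ sym R-id)
    ; homomorphism = ext-unique
        (ext-β _ ○ sym C.assoc ○ ∘-resp-≈ˡ (sym (ext-β _)) ○ C.assoc ○ sym (R-β _ _))
    ; F-resp-≈     = λ p → ext-unique (ext-β _ ○ ∘-resp-≈ʳ p ○ sym (ext-β _))
    }

  L⊣R : Adjunction L R
  L⊣R = record
    { unit   = record { η = ι ; commute = λ f → sym (ext-β _) }
    ; counit = record
      { η       = λ B → ext C.id
      ; commute = λ g → ext-unique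
          (R-β _ _ ○ sym C.assoc ○ ∘-resp-≈ˡ (ext-β _) ○ C.idˡ ○
           sym C.idʳ ○ sym (R-β _ _))
      }
    ; zig    = ext-unique
        (R-β _ _ ○ sym C.assoc ○ ∘-resp-≈ˡ (ext-β _) ○ C.idˡ ○ sym R-id)
    ; zag    = ext-β _
    }

record ℚ⁺ : Set where
  constructor mk⁺
  field
    value   : ℚ
    .nonNeg : ℚ.NonNegative value

open ℚ⁺ using (value)

infix 4 _≤⁺_ _<⁺_
_≤⁺_ _<⁺_ : ℚ⁺ → ℚ⁺ → Set
ε ≤⁺ δ = value ε ℚ.≤ value δ
ε <⁺ δ = value ε ℚ.< value δ

0⁺ : ℚ⁺
0⁺ = mk⁺ 0ℚ _

infixl 6 _+⁺_
_+⁺_ : ℚ⁺ → ℚ⁺ → ℚ⁺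
mk⁺ p p≥0 +⁺ mk⁺ q q≥0 = mk⁺ (p ℚ.+ q) (ℚₚ.nonNeg+nonNeg⇒nonNeg p {{p≥0}} q {{q≥0}})

<⁺-dense : ∀ {ε δ} → ε <⁺ δ → ∃ λ m → ε <⁺ m × m <⁺ δ
<⁺-dense {mk⁺ ε ε≥0} ε<δ with ℚₚ.<-dense ε<δ
... | m , ε<m , m<δ =
  mk⁺ m (ℚ.nonNegative (ℚₚ.≤-trans (ℚₚ.nonNegative⁻¹ ε {{ε≥0}}) (ℚₚ.<⇒≤ ε<m))) , ε<m , m<δ

-- r ∈ [0,∞] is represented by its closed upper cut, the set of all
-- rationals ε ≥ 0 with r ≤ ε; the empty cut is ∞.  Classically every such
-- cut arises from a unique r; no locatedness is assumed.
record [0,∞] (ℓ : Level) : Set (lsuc ℓ) where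
  no-eta-equality
  field
    Above  : ℚ⁺ → Set ℓ
    upper  : ∀ {ε δ} → ε ≤⁺ δ → Above ε → Above δ
    closed : ∀ {ε} → (∀ δ → ε <⁺ δ → Above δ) → Above ε

open [0,∞] using (Above; upper; closed)

infix 4 _≤∞_ _≈∞_

record _≤∞_ {ℓ} (r s : [0,∞] ℓ) : Set ℓ where
  constructor mk≤
  field
    at : ∀ {ε} → Above s ε → Above r ε

open _≤∞_ using (at)

_≈∞_ : ∀ {ℓ} → [0,∞] ℓ → [0,∞] ℓ → Set ℓ
r ≈∞ s = r ≤∞ s × s ≤∞ r

⌜_⌝ : ∀ {ℓ} → ℚ⁺ → [0,∞] ℓ
⌜_⌝ {ℓ} ε .Above δ                = Lift ℓ (ε ≤⁺ δ)
⌜ ε ⌝     .upper δ≤δ′ (lift ε≤δ)  = lift (ℚₚ.≤-trans ε≤δ δ≤δ′)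
⌜ ε ⌝     .closed {δ} h           = lift (ℚₚ.≮⇒≥ λ δ<ε →
  let m , δ<m , m<ε = <⁺-dense {δ} {ε} δ<ε
  in ℚₚ.<-irrefl ≡.refl (ℚₚ.<-≤-trans m<ε (lower (h m δ<m))))

0∞ : ∀ {ℓ} → [0,∞] ℓ
0∞ = ⌜ 0⁺ ⌝

-- The sums δ + δ′ of rational upper bounds need not form a closed cut.
infixl 6 _+∞_
_+∞_ : ∀ {ℓ} → [0,∞] ℓ → [0,∞] ℓ → [0,∞] ℓ
(r +∞ s) .Above ε              = ∀ ε′ → ε <⁺ ε′ →
  ∃₂ λ δ δ′ → Above r δ × Above s δ′ × δ +⁺ δ′ ≤⁺ ε′
(r +∞ s) .upper ε≤δ h ε′ δ<ε′  = h ε′ (ℚₚ.≤-<-trans ε≤δ δ<ε′)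
(r +∞ s) .closed {ε} h ε′ ε<ε′ =
  let m , ε<m , m<ε′ = <⁺-dense {ε} {ε′} ε<ε′ in h m ε<m ε′ m<ε′

-- max∞ r ≤ ε iff r i ≤ ε for all i; the maximum of the empty family is 0.
max∞ : ∀ {ℓ n} → Vector ([0,∞] ℓ) n → [0,∞] ℓ
max∞ r .Above ε       = ∀ i → Above (r i) ε
max∞ r .upper ε≤δ h i = upper (r i) ε≤δ (h i)
max∞ r .closed h i    = closed (r i) λ δ ε<δ → h δ ε<δ i

≤∞-refl : ∀ {ℓ} {r : [0,∞] ℓ} → r ≤∞ r
≤∞-refl .at p = p

≤∞-trans : ∀ {ℓ} {r s t : [0,∞] ℓ} → r ≤∞ s → s ≤∞ t → r ≤∞ t
≤∞-trans p q .at x = p .at (q .at x)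

≤∞-isPartialOrder : ∀ {ℓ} → IsPartialOrder (_≈∞_ {ℓ}) _≤∞_
≤∞-isPartialOrder = record
  { isPreorder = record
    { isEquivalence = record
      { refl  = ≤∞-refl , ≤∞-refl
      ; sym   = λ (p , q) → q , p
      ; trans = λ (p , q) (p′ , q′) → ≤∞-trans p p′ , ≤∞-trans q′ q
      }
    ; reflexive     = proj₁
    ; trans         = ≤∞-trans
    }
  ; antisym    = _,_
  }

≤⌜⌝⇒Above : ∀ {ℓ} {r : [0,∞] ℓ} {ε} → r ≤∞ ⌜ ε ⌝ → Above r ε
≤⌜⌝⇒Above p = p .at (lift ℚₚ.≤-refl)

Above⇒≤⌜⌝ : ∀ {ℓ} {r : [0,∞] ℓ} {ε} → Above r ε → r ≤∞ ⌜ ε ⌝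
Above⇒≤⌜⌝ {r = r} x .at (lift ε≤δ) = upper r ε≤δ x

0∞-min : ∀ {ℓ} {r : [0,∞] ℓ} → 0∞ ≤∞ r
0∞-min .at {mk⁺ ε ε≥0} _ = lift (ℚₚ.nonNegative⁻¹ ε {{ε≥0}})

+∞-mono : ∀ {ℓ} {r r′ s s′ : [0,∞] ℓ} → r ≤∞ r′ → s ≤∞ s′ → r +∞ s ≤∞ r′ +∞ s′
+∞-mono p q .at h ε′ ε<ε′ =
  let δ , δ′ , x , y , le = h ε′ ε<ε′ in δ , δ′ , p .at x , q .at y , le

+∞-identityˡ : ∀ {ℓ} {r : [0,∞] ℓ} → 0∞ +∞ r ≤∞ r
+∞-identityˡ .at {ε} x ε′ ε<ε′ =
  0⁺ , ε , lift ℚₚ.≤-refl , x ,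
  ℚₚ.≤-trans (ℚₚ.≤-reflexive (ℚₚ.+-identityˡ (value ε))) (ℚₚ.<⇒≤ ε<ε′)

+∞-identityʳ : ∀ {ℓ} {r : [0,∞] ℓ} → r +∞ 0∞ ≤∞ r
+∞-identityʳ .at {ε} x ε′ ε<ε′ =
  ε , 0⁺ , x , lift ℚₚ.≤-refl ,
  ℚₚ.≤-trans (ℚₚ.≤-reflexive (ℚₚ.+-identityʳ (value ε))) (ℚₚ.<⇒≤ ε<ε′)

⌜⌝+⌜⌝≤ : ∀ {ℓ} {ε δ} → ⌜ ε ⌝ +∞ ⌜ δ ⌝ ≤∞ ⌜_⌝ {ℓ} (ε +⁺ δ)
⌜⌝+⌜⌝≤ {ε = ε} {δ} .at (lift le) ε′ ε<ε′ =
  ε , δ , lift ℚₚ.≤-refl , lift ℚₚ.≤-refl , ℚₚ.≤-trans le (ℚₚ.<⇒≤ ε<ε′)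

record ExtMetricSpace (ℓ : Level) : Set (lsuc ℓ) where
  infix 4 _≈_
  field
    Carrier         : Set ℓ
    _≈_             : Carrier → Carrier → Set ℓ
    d               : Carrier → Carrier → [0,∞] ℓ
    isGeneralMetric : IsGeneralMetric _≈_ _≈∞_ _≤∞_ 0∞ _+∞_ d

  open IsGeneralMetric isGeneralMetric public
    using (≈⇒0; 0⇒≈; triangle; cong)
    renaming (sym to d-sym; module EqC to Eq)

  ≈⇒≤0 : ∀ {x y} → x ≈ y → d x y ≤∞ 0∞
  ≈⇒≤0 p = proj₁ (≈⇒0 p)

  ≤0⇒≈ : ∀ {x y} → d x y ≤∞ 0∞ → x ≈ y
  ≤0⇒≈ p = 0⇒≈ (p , 0∞-min)

-- The remaining fields of IsGeneralMetric are consequences.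
mkExtMetricSpace : ∀ {ℓ} (Carrier : Set ℓ) (_≈_ : Carrier → Carrier → Set ℓ)
  (d : Carrier → Carrier → [0,∞] ℓ) →
  (∀ {x y} → x ≈ y → d x y ≤∞ 0∞) →
  (∀ {x y} → d x y ≤∞ 0∞ → x ≈ y) →
  (∀ x → d x x ≤∞ 0∞) →
  (∀ x y → d x y ≤∞ d y x) →
  (∀ x y z → d x z ≤∞ d x y +∞ d y z) →
  ExtMetricSpace ℓ
mkExtMetricSpace Carrier _≈_ d ≈⇒≤0 ≤0⇒≈ d-refl d-sym triangle = record
  { Carrier         = Carrier
  ; _≈_             = _≈_
  ; d               = d
  ; isGeneralMetric = record
    { isSemiMetric = record
      { isQuasiSemiMetric = record
        { isPreMetric = record
          { isProtoMetric = record
            { isPartialOrder  = ≤∞-isPartialOrder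
            ; ≈-isEquivalence = record { refl = ≈-refl ; sym = ≈-sym ; trans = ≈-trans }
            ; cong            = λ p q → cong≤ (≈-sym p) (≈-sym q) , cong≤ p q
            ; nonNegative     = 0∞-min
            }
          ; ≈⇒0           = λ p → ≈⇒≤0 p , 0∞-min
          }
        ; 0⇒≈         = λ p → ≤0⇒≈ (proj₁ p)
        }
      ; sym               = λ x y → d-sym x y , d-sym y x
      }
    ; triangle     = triangle
    }
  }
  where
  ≈-refl : ∀ {x} → x ≈ x
  ≈-refl = ≤0⇒≈ (d-refl _)
  ≈-sym : ∀ {x y} → x ≈ y → y ≈ x
  ≈-sym p = ≤0⇒≈ (≤∞-trans (d-sym _ _) (≈⇒≤0 p))
  ≈-trans : ∀ {x y z} → x ≈ y → y ≈ z → x ≈ z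
  ≈-trans p q = ≤0⇒≈ (≤∞-trans (triangle _ _ _)
    (≤∞-trans (+∞-mono (≈⇒≤0 p) (≈⇒≤0 q)) +∞-identityˡ))
  cong≤ : ∀ {x x′ y y′} → x ≈ x′ → y ≈ y′ → d x′ y′ ≤∞ d x y
  cong≤ p q =
    ≤∞-trans (triangle _ _ _)
    (≤∞-trans (+∞-mono (≈⇒≤0 (≈-sym p)) (triangle _ _ _))
    (≤∞-trans +∞-identityˡ
    (≤∞-trans (+∞-mono (≤∞-refl {r = d _ _}) (≈⇒≤0 q)) +∞-identityʳ)))

record NonExpansive {ℓ} (X Y : ExtMetricSpace ℓ) : Set ℓ where
  private
    module X = ExtMetricSpace X
    module Y = ExtMetricSpace Y
  field
    fun          : X.Carrier → Y.Carrier
    nonExpansive : ∀ x y → Y.d (fun x) (fun y) ≤∞ X.d x y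

  resp : ∀ {x y} → x X.≈ y → fun x Y.≈ fun y
  resp p = Y.≤0⇒≈ (≤∞-trans (nonExpansive _ _) (X.≈⇒≤0 p))

open NonExpansive using (fun; nonExpansive; resp)

idⁿ : ∀ {ℓ} {X : ExtMetricSpace ℓ} → NonExpansive X X
idⁿ = record { fun = λ x → x ; nonExpansive = λ x y → ≤∞-refl }

infixr 9 _∘ⁿ_
_∘ⁿ_ : ∀ {ℓ} {X Y Z : ExtMetricSpace ℓ} →
       NonExpansive Y Z → NonExpansive X Y → NonExpansive X Z
g ∘ⁿ f = record
  { fun          = λ x → fun g (fun f x)
  ; nonExpansive = λ x y → ≤∞-trans (nonExpansive g _ _) (nonExpansive f x y)
  }

Met : ∀ ℓ → Category (lsuc ℓ) ℓ ℓ
Met ℓ = record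
  { Obj      = ExtMetricSpace ℓ
  ; _⇒_      = NonExpansive
  ; _≈_      = λ {X} {Y} f g → ∀ x → ExtMetricSpace._≈_ Y (fun f x) (fun g x)
  ; id       = idⁿ
  ; _∘_      = _∘ⁿ_
  ; equiv    = λ {X} {Y} → record
    { refl  = λ x → ExtMetricSpace.Eq.refl Y
    ; sym   = λ p x → ExtMetricSpace.Eq.sym Y (p x)
    ; trans = λ p q x → ExtMetricSpace.Eq.trans Y (p x) (q x)
    }
  ; ∘-resp-≈ = λ {A} {B} {C} {f} {h} {g} {i} p q x →
      ExtMetricSpace.Eq.trans C (resp f (q x)) (p (fun i x))
  ; assoc    = λ {A} {B} {C} {D} x → ExtMetricSpace.Eq.refl D
  ; idˡ      = λ {A} {B} x → ExtMetricSpace.Eq.refl B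
  ; idʳ      = λ {A} {B} x → ExtMetricSpace.Eq.refl B
  }

Power : ∀ {ℓ} → ExtMetricSpace ℓ → ℕ → ExtMetricSpace ℓ
Power X n = mkExtMetricSpace (Vector Carrier n)
  (λ u v → ∀ i → u i ≈ v i)
  (λ u v → max∞ λ i → d (u i) (v i))
  (λ p → mk≤ λ x i → ≈⇒≤0 (p i) .at x)
  (λ p i → ≤0⇒≈ (mk≤ λ x → p .at x i))
  (λ u → mk≤ λ x i → ≈⇒≤0 Eq.refl .at x)
  (λ u v → mk≤ λ x i → proj₁ (d-sym (u i) (v i)) .at (x i))
  (λ u v w → mk≤ λ {ε} h i → triangle (u i) (v i) (w i) .at {ε} λ ε′ ε<ε′ →
    let δ , δ′ , x , y , le = h ε′ ε<ε′ in δ , δ′ , x i , y i , le)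
  where open ExtMetricSpace X

record Signature (ℓ : Level) : Set (lsuc ℓ) where
  field
    Op    : Set ℓ
    arity : Op → ℕ

open Signature using (Op; arity)

data Term {ℓ a} (S : Signature ℓ) (X : Set a) : Set (ℓ ⊔ a) where
  var : X → Term S X
  op  : (f : Op S) → Vector (Term S X) (arity S f) → Term S X

fold : ∀ {ℓ a b} {S : Signature ℓ} {X : Set a} {B : Set b} →
       (X → B) → ((f : Op S) → Vector B (arity S f) → B) → Term S X → B
fold ι α (var x)   = ι x
fold ι α (op f ts) = α f λ i → fold ι α (ts i)

infixl 8 _[_]
_[_] : ∀ {ℓ a b} {S : Signature ℓ} {X : Set a} {Y : Set b} →
       Term S X → (X → Term S Y) → Term S Y
t [ σ ] = fold σ op t

V : Set
V = ℕ

infix 6 _=[_]_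
record QEq {ℓ} (S : Signature ℓ) : Set ℓ where
  constructor _=[_]_
  field
    lhs   : Term S V
    bound : ℚ⁺
    rhs   : Term S V

-- The finite set of premises is given by a list enumerating it.
infix 3 _⊢_
record CondQEq {ℓ} (S : Signature ℓ) : Set ℓ where
  constructor _⊢_
  field
    premises   : List (QEq S)
    conclusion : QEq S

mapQEq : ∀ {ℓ} {S S′ : Signature ℓ} → (Term S V → Term S′ V) → QEq S → QEq S′
mapQEq h (t =[ ε ] s) = h t =[ ε ] h s

mapCondQEq : ∀ {ℓ} {S S′ : Signature ℓ} → (Term S V → Term S′ V) → CondQEq S → CondQEq S′
mapCondQEq h (Γ ⊢ φ) = List.map (mapQEq h) Γ ⊢ mapQEq h φ

record IsTheory {ℓ u} {S : Signature ℓ} (U : Pred (CondQEq S) u) : Set (ℓ ⊔ u) where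
  field
    refl         : ∀ x → ([] ⊢ var x =[ 0⁺ ] var x) ∈ U
    symm         : ∀ x y ε → (var x =[ ε ] var y ∷ [] ⊢ var y =[ ε ] var x) ∈ U
    triang       : ∀ x y z ε ε′ →
                   (var x =[ ε ] var z ∷ var z =[ ε′ ] var y ∷ []
                     ⊢ var x =[ ε +⁺ ε′ ] var y) ∈ U
    weaken       : ∀ x y ε ε′ → 0⁺ <⁺ ε′ →
                   (var x =[ ε ] var y ∷ [] ⊢ var x =[ ε +⁺ ε′ ] var y) ∈ U
    nonexp       : ∀ f (xs ys : Vector V (arity S f)) ε →
                   (List.tabulate (λ i → var (xs i) =[ ε ] var (ys i))
                     ⊢ op f (λ i → var (xs i)) =[ ε ] op f (λ i → var (ys i))) ∈ U
    continuity   : ∀ {Γ t s ε} → (∀ ε′ → ε <⁺ ε′ → (Γ ⊢ t =[ ε′ ] s) ∈ U) →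
                   (Γ ⊢ t =[ ε ] s) ∈ U
    substitution : ∀ {χ} (σ : V → Term S V) → χ ∈ U → mapCondQEq (_[ σ ]) χ ∈ U
    assumption   : ∀ {Γ φ} → φ ∈ˡ Γ → (Γ ⊢ φ) ∈ U
    cut          : ∀ {Γ Θ ψ} → (∀ {φ} → φ ∈ˡ Θ → (Γ ⊢ φ) ∈ U) → (Θ ⊢ ψ) ∈ U →
                   (Γ ⊢ ψ) ∈ U

record Theory {ℓ} (S : Signature ℓ) : Set (lsuc ℓ) where
  field
    members  : Pred (CondQEq S) ℓ
    isTheory : IsTheory members

open Theory using (members)

-- The smallest theory containing A, by generated-isTheory, generated-⊇
-- and generated-least.
data Generated {ℓ} {S : Signature ℓ} (A : Pred (CondQEq S) ℓ) : Pred (CondQEq S) ℓ where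
  axiom        : ∀ {χ} → χ ∈ A → Generated A χ
  refl         : ∀ x → Generated A ([] ⊢ var x =[ 0⁺ ] var x)
  symm         : ∀ x y ε → Generated A (var x =[ ε ] var y ∷ [] ⊢ var y =[ ε ] var x)
  triang       : ∀ x y z ε ε′ →
                 Generated A (var x =[ ε ] var z ∷ var z =[ ε′ ] var y ∷ []
                   ⊢ var x =[ ε +⁺ ε′ ] var y)
  weaken       : ∀ x y ε ε′ → 0⁺ <⁺ ε′ →
                 Generated A (var x =[ ε ] var y ∷ [] ⊢ var x =[ ε +⁺ ε′ ] var y)
  nonexp       : ∀ f (xs ys : Vector V (arity S f)) ε →
                 Generated A (List.tabulate (λ i → var (xs i) =[ ε ] var (ys i))
                   ⊢ op f (λ i → var (xs i)) =[ ε ] op f (λ i → var (ys i)))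
  continuity   : ∀ {Γ t s ε} → (∀ ε′ → ε <⁺ ε′ → Generated A (Γ ⊢ t =[ ε′ ] s)) →
                 Generated A (Γ ⊢ t =[ ε ] s)
  substitution : ∀ {χ} (σ : V → Term S V) → Generated A χ →
                 Generated A (mapCondQEq (_[ σ ]) χ)
  assumption   : ∀ {Γ φ} → φ ∈ˡ Γ → Generated A (Γ ⊢ φ)
  cut          : ∀ {Γ Θ ψ} → (∀ {φ} → φ ∈ˡ Θ → Generated A (Γ ⊢ φ)) →
                 Generated A (Θ ⊢ ψ) → Generated A (Γ ⊢ ψ)

generated-isTheory : ∀ {ℓ} {S : Signature ℓ} (A : Pred (CondQEq S) ℓ) → IsTheory (Generated A)
generated-isTheory A = record
  { refl         = refl
  ; symm         = symm
  ; triang       = triang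
  ; weaken       = weaken
  ; nonexp       = nonexp
  ; continuity   = continuity
  ; substitution = substitution
  ; assumption   = assumption
  ; cut          = cut
  }

generated-⊇ : ∀ {ℓ} {S : Signature ℓ} (A : Pred (CondQEq S) ℓ) → A ⊆ Generated A
generated-⊇ A = axiom

generated-least : ∀ {ℓ u} {S : Signature ℓ} (A : Pred (CondQEq S) ℓ) {W : Pred (CondQEq S) u} →
                  IsTheory W → A ⊆ W → Generated A ⊆ W
generated-least A {W} thy A⊆W = go
  where
  module W = IsTheory thy
  go : Generated A ⊆ W
  go (axiom a)              = A⊆W a
  go (refl x)               = W.refl x
  go (symm x y ε)           = W.symm x y ε
  go (triang x y z ε ε′)    = W.triang x y z ε ε′
  go (weaken x y ε ε′ 0<ε′) = W.weaken x y ε ε′ 0<ε′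
  go (nonexp f xs ys ε)     = W.nonexp f xs ys ε
  go (continuity h)         = W.continuity λ ε′ ε<ε′ → go (h ε′ ε<ε′)
  go (substitution σ p)     = W.substitution σ (go p)
  go (assumption m)         = W.assumption m
  go (cut h p)              = W.cut (λ m → go (h m)) (go p)

generatedTheory : ∀ {ℓ} {S : Signature ℓ} → Pred (CondQEq S) ℓ → Theory S
generatedTheory A = record { members = Generated A ; isTheory = generated-isTheory A }

infix 4 _Axiomatizes_
_Axiomatizes_ : ∀ {ℓ} {S : Signature ℓ} → Pred (CondQEq S) ℓ → Theory S → Set ℓ
A Axiomatizes U = members U ≐ Generated A

data IsVar {ℓ} {S : Signature ℓ} : Term S V → Set ℓ where
  var : ∀ x → IsVar (var x)

HasVarPremises : ∀ {ℓ} {S : Signature ℓ} → CondQEq S → Set ℓ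
HasVarPremises (Γ ⊢ φ) = All (λ e → IsVar (QEq.lhs e) × IsVar (QEq.rhs e)) Γ

IsBasic : ∀ {ℓ} {S : Signature ℓ} → Theory S → Set (lsuc ℓ)
IsBasic {ℓ} {S} U = ∃ λ (A : Pred (CondQEq S) ℓ) → A ⊆ HasVarPremises × A Axiomatizes U

infixr 6 _⊎ˢ_ _⊕_
_⊎ˢ_ : ∀ {ℓ} → Signature ℓ → Signature ℓ → Signature ℓ
S ⊎ˢ S′ = record { Op = Op S ⊎ Op S′ ; arity = [ arity S , arity S′ ]′ }

embed₁ : ∀ {ℓ a} {S S′ : Signature ℓ} {X : Set a} → Term S X → Term (S ⊎ˢ S′) X
embed₁ = fold var λ f → op (inj₁ f)

embed₂ : ∀ {ℓ a} {S S′ : Signature ℓ} {X : Set a} → Term S′ X → Term (S ⊎ˢ S′) X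
embed₂ = fold var λ f → op (inj₂ f)

data Union {ℓ} {S S′ : Signature ℓ} (U : Theory S) (U′ : Theory S′) :
           Pred (CondQEq (S ⊎ˢ S′)) ℓ where
  left  : ∀ {χ} → χ ∈ members U → Union U U′ (mapCondQEq embed₁ χ)
  right : ∀ {χ} → χ ∈ members U′ → Union U U′ (mapCondQEq embed₂ χ)

_⊕_ : ∀ {ℓ} {S S′ : Signature ℓ} → Theory S → Theory S′ → Theory (S ⊎ˢ S′)
U ⊕ U′ = generatedTheory (Union U U′)

record QAlgebra {ℓ} (S : Signature ℓ) : Set (lsuc ℓ) where
  field
    space : ExtMetricSpace ℓ
    ⟦_⟧   : (f : Op S) → NonExpansive (Power space (arity S f)) space

  open ExtMetricSpace space public

  eval : ∀ {a} {X : Set a} → (X → Carrier) → Term S X → Carrier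
  eval ι = fold ι λ f → fun ⟦ f ⟧

  Holds : (V → Carrier) → QEq S → Set ℓ
  Holds ι (t =[ ε ] s) = d (eval ι t) (eval ι s) ≤∞ ⌜ ε ⌝

infix 4 _⊨_
_⊨_ : ∀ {ℓ} {S : Signature ℓ} → QAlgebra S → CondQEq S → Set ℓ
A ⊨ (Γ ⊢ φ) = ∀ (ι : V → Carrier) → (∀ {e} → e ∈ˡ Γ → Holds ι e) → Holds ι φ
  where open QAlgebra A

record Hom {ℓ} {S : Signature ℓ} (A B : QAlgebra S) : Set ℓ where
  private
    module A = QAlgebra A
    module B = QAlgebra B
  field
    map  : NonExpansive A.space B.space
    pres : ∀ f (as : Vector A.Carrier (arity S f)) →
           fun map (fun A.⟦ f ⟧ as) B.≈ fun B.⟦ f ⟧ (λ i → fun map (as i))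

record Model {ℓ} {S : Signature ℓ} (U : Theory S) : Set (lsuc ℓ) where
  field
    algebra   : QAlgebra S
    satisfies : ∀ {χ} → χ ∈ members U → algebra ⊨ χ

  open QAlgebra algebra public

𝕂 : ∀ {ℓ} (S : Signature ℓ) (U : Theory S) → Category (lsuc ℓ) ℓ ℓ
𝕂 S U = record
  { Obj      = Model U
  ; _⇒_      = λ A B → Hom (Model.algebra A) (Model.algebra B)
  ; _≈_      = λ {A} {B} f g → ∀ x → Model._≈_ B (fun (Hom.map f) x) (fun (Hom.map g) x)
  ; id       = λ {A} → record { map = idⁿ ; pres = λ f as → Model.Eq.refl A }
  ; _∘_      = λ {A} {B} {C} g f → record
    { map  = Hom.map g ∘ⁿ Hom.map f
    ; pres = λ h as → Model.Eq.trans C (resp (Hom.map g) (Hom.pres f h as)) (Hom.pres g h _)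
    }
  ; equiv    = λ {A} {B} → record
    { refl  = λ x → Model.Eq.refl B
    ; sym   = λ p x → Model.Eq.sym B (p x)
    ; trans = λ p q x → Model.Eq.trans B (p x) (q x)
    }
  ; ∘-resp-≈ = λ {A} {B} {C} {f} {h} {g} {i} p q x →
      Model.Eq.trans C (resp (Hom.map f) (q x)) (p (fun (Hom.map i) x))
  ; assoc    = λ {A} {B} {C} {D} x → Model.Eq.refl D
  ; idˡ      = λ {A} {B} x → Model.Eq.refl B
  ; idʳ      = λ {A} {B} x → Model.Eq.refl B
  }

Forget : ∀ {ℓ} {S : Signature ℓ} (U : Theory S) → Functor (𝕂 S U) (Met ℓ)
Forget U = record
  { F₀           = Model.space
  ; F₁           = Hom.map
  ; identity     = λ {A} x → Model.Eq.refl A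
  ; homomorphism = λ {A} {B} {C} x → Model.Eq.refl C
  ; F-resp-≈     = λ p → p
  }

-- The free model of U on X consists of the terms over X, where d t s ≤ ε
-- iff Provable U X t ε s, and terms at distance 0 are identified.
data Provable {ℓ} {S : Signature ℓ} (U : Theory S) (X : ExtMetricSpace ℓ) :
  Term S (ExtMetricSpace.Carrier X) → ℚ⁺ → Term S (ExtMetricSpace.Carrier X) → Set ℓ where
  gen        : ∀ {x y ε} → ExtMetricSpace.d X x y ≤∞ ⌜ ε ⌝ → Provable U X (var x) ε (var y)
  axiom      : ∀ {Γ t ε s} → (Γ ⊢ t =[ ε ] s) ∈ members U → (σ : V → Term S (ExtMetricSpace.Carrier X)) →
               (∀ {e} → e ∈ˡ Γ →
                 Provable U X (QEq.lhs e [ σ ]) (QEq.bound e) (QEq.rhs e [ σ ])) →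
               Provable U X (t [ σ ]) ε (s [ σ ])
  refl       : ∀ {t} → Provable U X t 0⁺ t
  symm       : ∀ {t s ε} → Provable U X t ε s → Provable U X s ε t
  triang     : ∀ {t s u ε δ} → Provable U X t ε s → Provable U X s δ u →
               Provable U X t (ε +⁺ δ) u
  weaken     : ∀ {t s ε δ} → ε ≤⁺ δ → Provable U X t ε s → Provable U X t δ s
  nonexp     : ∀ {f ts ss ε} → (∀ i → Provable U X (ts i) ε (ss i)) →
               Provable U X (op f ts) ε (op f ss)
  continuity : ∀ {t s ε} → (∀ ε′ → ε <⁺ ε′ → Provable U X t ε′ s) → Provable U X t ε s

freeSpace : ∀ {ℓ} {S : Signature ℓ} (U : Theory S) → ExtMetricSpace ℓ → ExtMetricSpace ℓ
freeSpace {S = S} U X = mkExtMetricSpace (Term S (ExtMetricSpace.Carrier X))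
  (λ t s → dist t s ≤∞ 0∞) dist (λ p → p) (λ p → p)
  (λ t → Above⇒≤⌜⌝ refl)
  (λ t s → mk≤ symm)
  (λ t s u → mk≤ λ {ε} h → continuity λ ε′ ε<ε′ →
    let δ , δ′ , p , q , le = h ε′ ε<ε′ in weaken le (triang p q))
  where
  dist : Term S (ExtMetricSpace.Carrier X) → Term S (ExtMetricSpace.Carrier X) → [0,∞] _
  dist t s .Above ε = Provable U X t ε s
  dist t s .upper   = weaken
  dist t s .closed  = continuity

freeModel : ∀ {ℓ} {S : Signature ℓ} (U : Theory S) → ExtMetricSpace ℓ → Model U
freeModel U X = record
  { algebra   = record
    { space = freeSpace U X
    ; ⟦_⟧   = λ f → record
      { fun          = op f
      ; nonExpansive = λ ts ss → mk≤ nonexp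
      }
    }
  ; satisfies = λ χ∈U σ h → Above⇒≤⌜⌝ (axiom χ∈U σ λ e∈Γ → ≤⌜⌝⇒Above (h e∈Γ))
  }

module _ {ℓ} {S : Signature ℓ} {U : Theory S} {X : ExtMetricSpace ℓ} (B : Model U)
         (f : NonExpansive X (Model.space B)) where
  open Model B

  private
    ⟦_⟧ᶠ : Term S (ExtMetricSpace.Carrier X) → Carrier
    ⟦_⟧ᶠ = eval (fun f)

  eval-[] : ∀ {a} {Y : Set a} (t : Term S Y) (σ : Y → Term S (ExtMetricSpace.Carrier X)) →
            eval (λ y → ⟦ σ y ⟧ᶠ) t ≈ ⟦ t [ σ ] ⟧ᶠ
  eval-[] (var y)   σ = Eq.refl
  eval-[] (op g ts) σ = resp ⟦ g ⟧ λ i → eval-[] (ts i) σ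

  sound : ∀ {t ε s} → Provable U X t ε s → d ⟦ t ⟧ᶠ ⟦ s ⟧ᶠ ≤∞ ⌜ ε ⌝
  sound (gen p) = ≤∞-trans (nonExpansive f _ _) p
  sound (axiom {t = t} {s = s} χ∈U σ h) =
    ≤∞-trans (proj₂ (cong (eval-[] t σ) (eval-[] s σ)))
    (satisfies χ∈U (λ v → ⟦ σ v ⟧ᶠ) λ {e} e∈Γ →
      ≤∞-trans (proj₁ (cong (eval-[] (QEq.lhs e) σ) (eval-[] (QEq.rhs e) σ)))
      (sound (h e∈Γ)))
  sound refl = ≈⇒≤0 Eq.refl
  sound (symm p) = ≤∞-trans (proj₁ (d-sym _ _)) (sound p)
  sound (triang {ε = ε} {δ} p q) =
    ≤∞-trans (triangle _ _ _) (≤∞-trans (+∞-mono (sound p) (sound q)) (⌜⌝+⌜⌝≤ {ε = ε} {δ}))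
  sound (weaken {t} {s} ε≤δ p) =
    Above⇒≤⌜⌝ (upper (d ⟦ t ⟧ᶠ ⟦ s ⟧ᶠ) ε≤δ (≤⌜⌝⇒Above (sound p)))
  sound (nonexp {f = g} h) = ≤∞-trans (nonExpansive ⟦ g ⟧ _ _)
    (Above⇒≤⌜⌝ λ i → ≤⌜⌝⇒Above (sound (h i)))
  sound (continuity {t} {s} h) =
    Above⇒≤⌜⌝ (closed (d ⟦ t ⟧ᶠ ⟦ s ⟧ᶠ) λ ε′ ε<ε′ → ≤⌜⌝⇒Above (sound (h ε′ ε<ε′)))

  extend : Hom (Model.algebra (freeModel U X)) algebra
  extend = record
    { map  = record
      { fun          = ⟦_⟧ᶠ
      ; nonExpansive = λ t s → mk≤ λ p → ≤⌜⌝⇒Above (sound p)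
      }
    ; pres = λ g ts → Eq.refl
    }

freeArrows : ∀ {ℓ} {S : Signature ℓ} (U : Theory S) → UniversalArrows (Forget U)
freeArrows {S = S} U = record
  { L₀         = freeModel U
  ; ι          = λ X → record
    { fun          = var
    ; nonExpansive = λ x y → mk≤ λ p → gen (Above⇒≤⌜⌝ p)
    }
  ; ext        = λ {X} {B} f → extend B f
  ; ext-β      = λ {X} {B} f x → Model.Eq.refl B
  ; ext-unique = λ {X} {B} {g} {h} p → unique {X} B g h p
  }
  where
  unique : ∀ {X} (B : Model U) (g h : Hom (Model.algebra (freeModel U X)) (Model.algebra B)) →
           (∀ x → Model._≈_ B (fun (Hom.map g) (var x)) (fun (Hom.map h) (var x))) →
           ∀ t → Model._≈_ B (fun (Hom.map g) t) (fun (Hom.map h) t)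
  unique B g h p (var x)   = p x
  unique B g h p (op f ts) = trans (Hom.pres g f ts)
    (trans (resp (Model.⟦_⟧ B f) λ i → unique B g h p (ts i)) (sym (Hom.pres h f ts)))
    where open Model.Eq B

Free : ∀ {ℓ} {S : Signature ℓ} (U : Theory S) → Functor (Met ℓ) (𝕂 S U)
Free U = UniversalArrows.L (freeArrows U)

Free⊣Forget : ∀ {ℓ} {S : Signature ℓ} (U : Theory S) → Adjunction (Free U) (Forget U)
Free⊣Forget U = UniversalArrows.L⊣R (freeArrows U)

FreeMonad : ∀ {ℓ} {S : Signature ℓ} → Theory S → Monad (Met ℓ)
FreeMonad U = adjunction⇒monad (Free⊣Forget U)

{-# OPTIONS --safe #-}

-- A monad map α : T_U → H makes every H X a Σ-algebra through the
-- Eilenberg–Moore structure μ ∘ α : T_U (H X) → H X.  It satisfies U when U is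
-- basic: premises between variables that hold in H X hold already in T_U (H X),
-- where they imply the conclusion, and μ ∘ α is non-expansive.  Hence monad maps
-- T_U → H correspond to structures of U-models on all H X for which the maps H f
-- and μ are homomorphisms.  A model of U ⊕ U′ is a model of U and of U′ on the
-- same space, so such structures for U ⊕ U′ are pairs of such structures for U
-- and U′, which is the universal property of the coproduct.
module Submission where

open import Defs
open import Level using () renaming (suc to lsuc)
open import Data.Product.Base using (∃; _×_; _,_; proj₁; proj₂)
open import Data.Sum.Base using (inj₁; inj₂)
import Data.List.Base as List
open import Data.List.Membership.Propositional using () renaming (_∈_ to _∈ˡ_)
open import Data.List.Membership.Propositional.Properties
  using (∈-map⁺; ∈-map⁻; ∈-tabulate⁺)
import Data.List.Relation.Unary.All as All
open import Data.List.Relation.Unary.Any using (here; there)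
import Data.Rational.Properties as ℚₚ
open import Relation.Binary.Bundles using (Setoid)
import Relation.Binary.PropositionalEquality.Core as ≡
import Relation.Binary.Reasoning.Setoid as SetoidReasoning
open import Relation.Unary using (_∈_; _⊆_)

open Signature using (Op; arity)
open NonExpansive using (fun; nonExpansive; resp)
open [0,∞] using (upper; closed)
open Theory using (members)
open ℚ⁺ using (value)

setoid : ∀ {ℓ} → ExtMetricSpace ℓ → Setoid ℓ ℓ
setoid X = record
  { Carrier       = Carrier
  ; _≈_           = _≈_
  ; isEquivalence = record { refl = Eq.refl ; sym = Eq.sym ; trans = Eq.trans }
  }
  where open ExtMetricSpace X

-- Transfer of satisfaction along translations of terms

module _ {ℓ} {S S′ : Signature ℓ} (A : QAlgebra S)
         (ops : ∀ f → NonExpansive (Power (QAlgebra.space A) (arity S′ f)) (QAlgebra.space A))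
         (h : Term S V → Term S′ V) where

  private
    B : QAlgebra S′
    B = record { space = QAlgebra.space A ; ⟦_⟧ = ops }
    module A = QAlgebra A
    module B = QAlgebra B

  -- Two assignments are needed to cover substitutions, where `κ` is `ι` evaluated on the
  -- substituted terms; for the embeddings of signatures `κ` is `ι` itself.
  Translates : (V → A.Carrier) → (V → A.Carrier) → Set ℓ
  Translates ι κ = ∀ t → A.eval κ t A.≈ B.eval ι (h t)

  module _ {ι κ : V → A.Carrier} (p : Translates ι κ) where

    holds-map⁺ : ∀ e → A.Holds κ e → B.Holds ι (mapQEq h e)
    holds-map⁺ (t =[ ε ] s) q = ≤∞-trans (proj₂ (A.cong (p t) (p s))) q

    holds-map⁻ : ∀ e → B.Holds ι (mapQEq h e) → A.Holds κ e
    holds-map⁻ (t =[ ε ] s) q = ≤∞-trans (proj₁ (A.cong (p t) (p s))) q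

  ⊨-map⁺ : ∀ χ → (∀ ι → ∃ (Translates ι)) → A ⊨ χ → B ⊨ mapCondQEq h χ
  ⊨-map⁺ (Γ ⊢ φ) tr A⊨χ ι q =
    let κ , p = tr ι in
    holds-map⁺ p φ (A⊨χ κ λ {e} e∈Γ → holds-map⁻ p e (q (∈-map⁺ (mapQEq h) e∈Γ)))

  ⊨-map⁻ : ∀ χ → (∀ κ → Translates κ κ) → B ⊨ mapCondQEq h χ → A ⊨ χ
  ⊨-map⁻ (Γ ⊢ φ) tr B⊨χ κ q = holds-map⁻ (tr κ) φ (B⊨χ κ premise)
    where
    premise : ∀ {e′} → e′ ∈ˡ List.map (mapQEq h) Γ → B.Holds κ e′
    premise e′∈ with ∈-map⁻ (mapQEq h) e′∈
    ... | e , e∈Γ , ≡.refl = holds-map⁺ (tr κ) e (q e∈Γ)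

module _ {ℓ} {S : Signature ℓ} (A : QAlgebra S) where
  open QAlgebra A

  eval-subst : ∀ {a b} {X : Set a} {Y : Set b} (ι : Y → Carrier) (σ : X → Term S Y) t →
               eval (λ x → eval ι (σ x)) t ≈ eval ι (t [ σ ])
  eval-subst ι σ (var x)   = Eq.refl
  eval-subst ι σ (op f ts) = resp ⟦ f ⟧ λ i → eval-subst ι σ (ts i)

  -- With `generated-least` this reduces satisfaction of a generated theory to satisfaction of its
  -- axioms.
  satisfied-isTheory : IsTheory (A ⊨_)
  satisfied-isTheory = record
    { refl         = λ x ι h → ≈⇒≤0 Eq.refl
    ; symm         = λ x y ε ι h → ≤∞-trans (proj₁ (d-sym _ _)) (h (here ≡.refl))
    ; triang       = λ x y z ε ε′ ι h → ≤∞-trans (triangle _ _ _)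
        (≤∞-trans (+∞-mono (h (here ≡.refl)) (h (there (here ≡.refl))))
                  (⌜⌝+⌜⌝≤ {ε = ε} {ε′}))
    ; weaken       = λ x y ε ε′ 0<ε′ ι h → Above⇒≤⌜⌝
        (upper (d (ι x) (ι y))
          (ℚₚ.≤-trans (ℚₚ.≤-reflexive (≡.sym (ℚₚ.+-identityʳ (value ε))))
                      (ℚₚ.+-monoʳ-≤ (value ε) (ℚₚ.<⇒≤ 0<ε′)))
          (≤⌜⌝⇒Above (h (here ≡.refl))))
    ; nonexp       = λ f xs ys ε ι h → ≤∞-trans (nonExpansive ⟦ f ⟧ _ _)
        (Above⇒≤⌜⌝ λ i → ≤⌜⌝⇒Above (h (∈-tabulate⁺ i)))
    ; continuity   = λ {Γ} {t} {s} h ι q → Above⇒≤⌜⌝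
        (closed (d (eval ι t) (eval ι s)) λ ε′ ε<ε′ → ≤⌜⌝⇒Above (h ε′ ε<ε′ ι q))
    ; substitution = λ {χ} σ → ⊨-map⁺ A ⟦_⟧ (_[ σ ]) χ λ ι →
        (λ v → eval ι (σ v)) , eval-subst ι σ
    ; assumption   = λ φ∈Γ ι h → h φ∈Γ
    ; cut          = λ h p ι q → p ι λ φ∈Θ → h φ∈Θ ι q
    }

-- Reducts to the two summand signatures

module _ {ℓ} {S S′ : Signature ℓ} (A : QAlgebra (S ⊎ˢ S′)) where
  open QAlgebra A

  reduct₁ : QAlgebra S
  reduct₁ = record { space = space ; ⟦_⟧ = λ f → ⟦ inj₁ f ⟧ }

  reduct₂ : QAlgebra S′
  reduct₂ = record { space = space ; ⟦_⟧ = λ f → ⟦ inj₂ f ⟧ }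

  eval-embed₁ : ∀ {a} {X : Set a} (ι : X → Carrier) t →
                QAlgebra.eval reduct₁ ι t ≈ eval ι (embed₁ t)
  eval-embed₁ ι (var x)   = Eq.refl
  eval-embed₁ ι (op f ts) = resp ⟦ inj₁ f ⟧ λ i → eval-embed₁ ι (ts i)

  eval-embed₂ : ∀ {a} {X : Set a} (ι : X → Carrier) t →
                QAlgebra.eval reduct₂ ι t ≈ eval ι (embed₂ t)
  eval-embed₂ ι (var x)   = Eq.refl
  eval-embed₂ ι (op f ts) = resp ⟦ inj₂ f ⟧ λ i → eval-embed₂ ι (ts i)

  module _ (U : Theory S) (U′ : Theory S′) where

    reduct₁-satisfies : (∀ {χ} → χ ∈ members (U ⊕ U′) → A ⊨ χ) →
                        ∀ {χ} → χ ∈ members U → reduct₁ ⊨ χ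
    reduct₁-satisfies sat {χ} χ∈U =
      ⊨-map⁻ reduct₁ ⟦_⟧ embed₁ χ eval-embed₁ (sat (axiom (left χ∈U)))

    reduct₂-satisfies : (∀ {χ} → χ ∈ members (U ⊕ U′) → A ⊨ χ) →
                        ∀ {χ} → χ ∈ members U′ → reduct₂ ⊨ χ
    reduct₂-satisfies sat {χ} χ∈U′ =
      ⊨-map⁻ reduct₂ ⟦_⟧ embed₂ χ eval-embed₂ (sat (axiom (right χ∈U′)))

    ⊕-satisfies : (∀ {χ} → χ ∈ members U → reduct₁ ⊨ χ) →
                  (∀ {χ} → χ ∈ members U′ → reduct₂ ⊨ χ) →
                  ∀ {χ} → χ ∈ members (U ⊕ U′) → A ⊨ χ
    ⊕-satisfies sat sat′ = generated-least (Union U U′) (satisfied-isTheory A) union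
      where
      union : Union U U′ ⊆ (A ⊨_)
      union (left {χ} χ∈U)   =
        ⊨-map⁺ reduct₁ ⟦_⟧ embed₁ χ (λ ι → ι , eval-embed₁ ι) (sat χ∈U)
      union (right {χ} χ∈U′) =
        ⊨-map⁺ reduct₂ ⟦_⟧ embed₂ χ (λ ι → ι , eval-embed₂ ι) (sat′ χ∈U′)

-- From model structures to monad maps

record ModelStructure {ℓ} {S : Signature ℓ} (U : Theory S) (H : Monad (Met ℓ)) :
                      Set (lsuc ℓ) where
  private module H = Monad H
  field
    operations : ∀ X f → NonExpansive (Power (H.F.F₀ X) (arity S f)) (H.F.F₀ X)

  algebra : ExtMetricSpace ℓ → QAlgebra S
  algebra X = record { space = H.F.F₀ X ; ⟦_⟧ = operations X }

  field
    satisfies : ∀ X {χ} → χ ∈ members U → algebra X ⊨ χ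
    F₁-pres   : ∀ {X Y} (g : NonExpansive X Y) f as → ExtMetricSpace._≈_ (H.F.F₀ Y)
                (fun (H.F.F₁ g) (fun (operations X f) as))
                (fun (operations Y f) (λ i → fun (H.F.F₁ g) (as i)))
    μ-pres    : ∀ X f as → ExtMetricSpace._≈_ (H.F.F₀ X)
                (fun (H.μ.η X) (fun (operations (H.F.F₀ X) f) as))
                (fun (operations X f) (λ i → fun (H.μ.η X) (as i)))

  model : ExtMetricSpace ℓ → Model U
  model X = record { algebra = algebra X ; satisfies = satisfies X }

  F₁-hom : ∀ {X Y} → NonExpansive X Y → Hom (algebra X) (algebra Y)
  F₁-hom g = record { map = H.F.F₁ g ; pres = F₁-pres g }

  μ-hom : ∀ X → Hom (algebra (H.F.F₀ X)) (algebra X)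
  μ-hom X = record { map = H.μ.η X ; pres = μ-pres X }

  open UniversalArrows (freeArrows U) using (ext; ext-unique; L; L⊣R)
  open Category (𝕂 S U) using (_∘_)

  private
    σ : ∀ X → Hom (Model.algebra (freeModel U X)) (algebra X)
    σ X = ext {X} {model X} (H.η.η X)

  -- Each component extends the unit of `H` to the free model. Naturality and multiplicativity
  -- compare homomorphisms out of a free model, so generators suffice; `F₁-pres` and `μ-pres` make
  -- the sides that involve `H` homomorphisms.
  monadMap : MonadMap (FreeMonad U) H
  monadMap = record
    { σ         = record
      { η       = λ X → Hom.map (σ X)
      ; commute = λ {X} {Y} f → ext-unique {X} {model Y}
          {_∘_ {freeModel U X} {freeModel U Y} {model Y} (σ Y) (Functor.F₁ L f)}
          {_∘_ {freeModel U X} {model X} {model Y} (F₁-hom f) (σ X)}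
          (H.η.commute f)
      }
    ; unit-comp = λ {X} x → ExtMetricSpace.Eq.refl (H.F.F₀ X)
    ; mult-comp = λ {X} → let TX = freeSpace U X in ext-unique {TX} {model X}
        {_∘_ {freeModel U TX} {freeModel U X} {model X} (σ X)
          (Adjunction.counit.η L⊣R (freeModel U X))}
        {_∘_ {freeModel U TX} {model TX} {model X}
          (_∘_ {model TX} {model (H.F.F₀ X)} {model X} (μ-hom X) (F₁-hom (Hom.map (σ X))))
          (σ TX)}
        -- A generator is here a whole term `t` over `X`; the counit returns it unchanged.
        λ t → let open SetoidReasoning (setoid (H.F.F₀ X)) in begin
          fun (Hom.map (σ X)) t
            ≈⟨ H.μ-idʳ _ ⟨
          fun (H.μ.η X) (fun (H.η.η _) (fun (Hom.map (σ X)) t))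
            ≈⟨ resp (H.μ.η X) (H.η.commute (Hom.map (σ X)) t) ⟩
          fun (H.μ.η X) (fun (H.F.F₁ (Hom.map (σ X))) (fun (H.η.η TX) t)) ∎
    }

module _ {ℓ} {S : Signature ℓ} (U : Theory S) where

  -- The flat term of `f`: followed by an action of the monad on `X`, it becomes an operation on
  -- `X`.
  operationⁿ : ∀ X f → NonExpansive (Power X (arity S f)) (freeSpace U X)
  operationⁿ X f = record
    { fun          = λ xs → op f λ i → var (xs i)
    ; nonExpansive = λ xs ys → mk≤ λ p → nonexp λ i → gen (Above⇒≤⌜⌝ (p i))
    }

  freeStructure : ModelStructure U (FreeMonad U)
  freeStructure = record
    { operations = λ X → Model.⟦_⟧ (freeModel U X)
    ; satisfies  = λ X → Model.satisfies (freeModel U X)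
    ; F₁-pres    = λ {X} {Y} g f as → ExtMetricSpace.Eq.refl (freeSpace U Y)
    ; μ-pres     = λ X f as → ExtMetricSpace.Eq.refl (freeSpace U X)
    }

-- From monad maps to model structures

module _ {ℓ} {S : Signature ℓ} {U : Theory S} {H : Monad (Met ℓ)}
         (α : MonadMap (FreeMonad U) H) where
  private
    module H = Monad H
    module T = Monad (FreeMonad U)
    module α = MonadMap α

  action : ∀ X → NonExpansive (T.F.F₀ (H.F.F₀ X)) (H.F.F₀ X)
  action X = H.μ.η X ∘ⁿ α.σ.η (H.F.F₀ X)

  inducedAlgebra : ExtMetricSpace ℓ → QAlgebra S
  inducedAlgebra X = record
    { space = H.F.F₀ X
    ; ⟦_⟧   = λ f → action X ∘ⁿ operationⁿ U (H.F.F₀ X) f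
    }

  module _ (X : ExtMetricSpace ℓ) where
    open SetoidReasoning (setoid (H.F.F₀ X))
    open ExtMetricSpace (H.F.F₀ X) using (_≈_; Carrier; module Eq)

    action-unit : ∀ x → fun (action X) (var x) ≈ x
    action-unit x = Eq.trans (resp (H.μ.η X) (α.unit-comp x)) (H.μ-idʳ x)

    -- The associativity law of an Eilenberg-Moore algebra, from multiplicativity and naturality of
    -- `α` and associativity of `μ`.
    action-assoc : ∀ t → fun (action X) (fun (T.μ.η (H.F.F₀ X)) t)
                       ≈ fun (action X) (fun (T.F.F₁ (action X)) t)
    action-assoc t = begin
      fun (H.μ.η X) (fun (α.σ.η HX) (fun (T.μ.η HX) t))
        ≈⟨ resp (H.μ.η X) (α.mult-comp t) ⟩
      fun (H.μ.η X) (fun (H.μ.η HX) (fun (H.F.F₁ (α.σ.η HX)) (fun (α.σ.η _) t)))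
        ≈⟨ H.μ-assoc _ ⟨
      fun (H.μ.η X) (fun (H.F.F₁ (H.μ.η X)) (fun (H.F.F₁ (α.σ.η HX)) (fun (α.σ.η _) t)))
        ≈⟨ resp (H.μ.η X) (H.F.homomorphism _) ⟨
      fun (H.μ.η X) (fun (H.F.F₁ (action X)) (fun (α.σ.η _) t))
        ≈⟨ resp (H.μ.η X) (α.σ.commute (action X) t) ⟨
      fun (action X) (fun (T.F.F₁ (action X)) t) ∎
      where
      HX = H.F.F₀ X

    -- Evaluation applies the action once per operation symbol; `action-assoc` merges these into one
    -- application to the whole term, whose non-expansiveness can then be used.
    eval-induced : ∀ {a} {Y : Set a} (ι : Y → Carrier) t →
                   QAlgebra.eval (inducedAlgebra X) ι t ≈
                   fun (action X) (t [ (λ y → var (ι y)) ])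
    eval-induced ι (var y)   = Eq.sym (action-unit (ι y))
    eval-induced ι (op f ts) = begin
      fun (action X) (op f λ i → var (QAlgebra.eval (inducedAlgebra X) ι (ts i)))
        ≈⟨ resp (QAlgebra.⟦_⟧ (inducedAlgebra X) f) (λ i → eval-induced ι (ts i)) ⟩
      fun (action X) (op f λ i → var (fun (action X) (ts i [ (λ y → var (ι y)) ])))
        ≈⟨ action-assoc (op f λ i → var (ts i [ (λ y → var (ι y)) ])) ⟨
      fun (action X) (op f λ i → ts i [ (λ y → var (ι y)) ]) ∎

    induced-⊨ : ∀ {χ} → HasVarPremises χ → χ ∈ members U → inducedAlgebra X ⊨ χ
    induced-⊨ {Γ ⊢ (t =[ ε ] s)} vars χ∈U ι h =
      ≤∞-trans (proj₁ (QAlgebra.cong (inducedAlgebra X) (eval-induced ι t) (eval-induced ι s)))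
      (≤∞-trans (nonExpansive (action X) _ _)
      (Above⇒≤⌜⌝ (axiom χ∈U (λ v → var (ι v)) λ e∈Γ → premise (All.lookup vars e∈Γ) (h e∈Γ))))
      where
      premise : ∀ {e} → IsVar (QEq.lhs e) × IsVar (QEq.rhs e) →
                QAlgebra.Holds (inducedAlgebra X) ι e →
                Provable U (H.F.F₀ X) (QEq.lhs e [ (λ v → var (ι v)) ]) (QEq.bound e)
                                      (QEq.rhs e [ (λ v → var (ι v)) ])
      -- Between variables, the premise bounds a distance in `H X`, which is what `gen` asks for.
      -- For compound terms it would only bound the distance of their values, not of the terms.
      premise (var x , var y) p = gen p

    -- The term `op f ts` is the multiplication applied to a flat term whose variables are the
    -- `ts i`; multiplicativity and naturality of `α` then apply.
    σ-pres : ∀ f ts → fun (α.σ.η X) (op f ts) ≈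
             fun (QAlgebra.⟦_⟧ (inducedAlgebra X) f) (λ i → fun (α.σ.η X) (ts i))
    σ-pres f ts = begin
      fun (α.σ.η X) (fun (T.μ.η X) (op f λ i → var (ts i)))
        ≈⟨ α.mult-comp (op f λ i → var (ts i)) ⟩
      fun (H.μ.η X) (fun (H.F.F₁ (α.σ.η X)) (fun (α.σ.η _) (op f λ i → var (ts i))))
        ≈⟨ resp (H.μ.η X) (α.σ.commute (α.σ.η X) (op f λ i → var (ts i))) ⟨
      fun (action X) (op f λ i → var (fun (α.σ.η X) (ts i))) ∎

  inducedStructure : IsBasic U → ModelStructure U H
  inducedStructure (A , vars , U⊆A , A⊆U) = record
    { operations = λ X → QAlgebra.⟦_⟧ (inducedAlgebra X)
    -- Only the axioms in `A` are known to have variable premises, so `induced-⊨` is used on them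
    -- alone.
    ; satisfies  = λ X χ∈U → generated-least A (satisfied-isTheory (inducedAlgebra X))
        (λ χ∈A → induced-⊨ X (vars χ∈A) (A⊆U (axiom χ∈A))) (U⊆A χ∈U)
    ; F₁-pres    = λ {X} {Y} g f as →
        let open SetoidReasoning (setoid (H.F.F₀ Y))
            t = op f λ i → var (as i)
        in begin
        fun (H.F.F₁ g) (fun (H.μ.η X) (fun (α.σ.η _) t))
          ≈⟨ H.μ.commute g _ ⟨
        fun (H.μ.η Y) (fun (H.F.F₁ (H.F.F₁ g)) (fun (α.σ.η _) t))
          ≈⟨ resp (H.μ.η Y) (α.σ.commute (H.F.F₁ g) t) ⟨
        fun (action Y) (op f λ i → var (fun (H.F.F₁ g) (as i))) ∎
    ; μ-pres     = λ X f as →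
        let open SetoidReasoning (setoid (H.F.F₀ X))
            t = op f λ i → var (as i)
        in begin
        fun (H.μ.η X) (fun (H.μ.η _) (fun (α.σ.η _) t))
          ≈⟨ H.μ-assoc _ ⟨
        fun (H.μ.η X) (fun (H.F.F₁ (H.μ.η X)) (fun (α.σ.η _) t))
          ≈⟨ resp (H.μ.η X) (α.σ.commute (H.μ.η X) t) ⟨
        fun (action X) (op f λ i → var (fun (H.μ.η X) (as i))) ∎
    }

-- Monad maps are determined by their operations

module _ {ℓ} {S : Signature ℓ} {U : Theory S} {H : Monad (Met ℓ)} where
  private
    module H = Monad H
    ⟦_⟧[_] : MonadMap (FreeMonad U) H → (X : ExtMetricSpace ℓ) (f : Op S) →
             NonExpansive (Power (H.F.F₀ X) (arity S f)) (H.F.F₀ X)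
    ⟦ α ⟧[ X ] = QAlgebra.⟦_⟧ (inducedAlgebra α X)

  -- Induction on terms: the unit law settles variables, `σ-pres` settles operations.
  monadMap-unique : (α β : MonadMap (FreeMonad U) H) →
    (∀ X f as → ExtMetricSpace._≈_ (H.F.F₀ X) (fun (⟦ α ⟧[ X ] f) as) (fun (⟦ β ⟧[ X ] f) as)) →
    Category._≈_ (Monads (Met ℓ)) α β
  monadMap-unique α β p X = go
    where
    module α = MonadMap α
    module β = MonadMap β
    open ExtMetricSpace (H.F.F₀ X) using (_≈_; module Eq)
    open SetoidReasoning (setoid (H.F.F₀ X))
    go : ∀ t → fun (α.σ.η X) t ≈ fun (β.σ.η X) t
    go (var x)   = Eq.trans (α.unit-comp x) (Eq.sym (β.unit-comp x))
    go (op f ts) = begin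
      fun (α.σ.η X) (op f ts)                           ≈⟨ σ-pres α X f ts ⟩
      fun (⟦ α ⟧[ X ] f) (λ i → fun (α.σ.η X) (ts i))  ≈⟨ p X f _ ⟩
      fun (⟦ β ⟧[ X ] f) (λ i → fun (α.σ.η X) (ts i))  ≈⟨ resp (⟦ β ⟧[ X ] f) (λ i → go (ts i)) ⟩
      fun (⟦ β ⟧[ X ] f) (λ i → fun (β.σ.η X) (ts i))  ≈⟨ σ-pres β X f ts ⟨
      fun (β.σ.η X) (op f ts)                           ∎

  -- The induced operation embeds its arguments by the unit, applies `f` in `H (H X)` and
  -- multiplies; since `μ` is a homomorphism, the unit law cancels the embedding.
  monadMap-operations : (M : ModelStructure U H) → let open ModelStructure M in
    ∀ X f as → ExtMetricSpace._≈_ (H.F.F₀ X)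
      (fun (⟦ monadMap ⟧[ X ] f) as) (fun (operations X f) as)
  monadMap-operations M X f as =
    Eq.trans (μ-pres X f _) (resp (operations X f) λ i → H.μ-idʳ (as i))
    where
    open ModelStructure M
    open ExtMetricSpace (H.F.F₀ X) using (module Eq)

-- Model structures for the sum of two theories

module _ {ℓ} {S S′ : Signature ℓ} {U : Theory S} {U′ : Theory S′} {H : Monad (Met ℓ)} where

  restrict₁ : ModelStructure (U ⊕ U′) H → ModelStructure U H
  restrict₁ M = record
    { operations = λ X f → operations X (inj₁ f)
    ; satisfies  = λ X → reduct₁-satisfies (algebra X) U U′ (satisfies X)
    ; F₁-pres    = λ g f → F₁-pres g (inj₁ f)
    ; μ-pres     = λ X f → μ-pres X (inj₁ f)
    }
    where open ModelStructure M

  restrict₂ : ModelStructure (U ⊕ U′) H → ModelStructure U′ H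
  restrict₂ M = record
    { operations = λ X f → operations X (inj₂ f)
    ; satisfies  = λ X → reduct₂-satisfies (algebra X) U U′ (satisfies X)
    ; F₁-pres    = λ g f → F₁-pres g (inj₂ f)
    ; μ-pres     = λ X f → μ-pres X (inj₂ f)
    }
    where open ModelStructure M

  combine : ModelStructure U H → ModelStructure U′ H → ModelStructure (U ⊕ U′) H
  combine M M′ = record
    { operations = operations
    ; satisfies  = λ X → ⊕-satisfies (record { ⟦_⟧ = operations X }) U U′
        (M.satisfies X) (M′.satisfies X)
    ; F₁-pres    = λ { g (inj₁ f) → M.F₁-pres g f ; g (inj₂ f) → M′.F₁-pres g f }
    ; μ-pres     = λ { X (inj₁ f) → M.μ-pres X f ; X (inj₂ f) → M′.μ-pres X f }
    }
    where
    module M  = ModelStructure M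
    module M′ = ModelStructure M′
    module H = Monad H
    operations : ∀ X f → NonExpansive (Power (H.F.F₀ X) (arity (S ⊎ˢ S′) f)) (H.F.F₀ X)
    operations X (inj₁ f) = M.operations X f
    operations X (inj₂ f) = M′.operations X f

-- The coproduct of the free monads

module _ {ℓ} {S S′ : Signature ℓ} (U : Theory S) (U′ : Theory S′) where

  -- On terms this is `embed₁`; obtaining it from a restricted structure yields the monad map laws
  -- at once.
  inclusion₁ : MonadMap (FreeMonad U) (FreeMonad (U ⊕ U′))
  inclusion₁ = ModelStructure.monadMap (restrict₁ (freeStructure (U ⊕ U′)))

  inclusion₂ : MonadMap (FreeMonad U′) (FreeMonad (U ⊕ U′))
  inclusion₂ = ModelStructure.monadMap (restrict₂ (freeStructure (U ⊕ U′)))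

module _ {ℓ} {S S′ : Signature ℓ} {U : Theory S} {U′ : Theory S′}
         (basic : IsBasic U) (basic′ : IsBasic U′) where
  open Category (Monads (Met ℓ)) using (_∘_; _≈_)

  module _ {H : Monad (Met ℓ)} (α : MonadMap (FreeMonad U) H)
           (β : MonadMap (FreeMonad U′) H) where
    private
      M = combine (inducedStructure α basic) (inducedStructure β basic′)

    copairing : MonadMap (FreeMonad (U ⊕ U′)) H
    copairing = ModelStructure.monadMap M

    copairing∘inclusion₁ : copairing ∘ inclusion₁ U U′ ≈ α
    copairing∘inclusion₁ = monadMap-unique (copairing ∘ inclusion₁ U U′) α
      -- The inclusion computes on the flat term of `f` to that of `inj₁ f`, and `M` interprets
      -- `inj₁ f` by the operation induced by `α`.
      λ X f → monadMap-operations M X (inj₁ f)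

    copairing∘inclusion₂ : copairing ∘ inclusion₂ U U′ ≈ β
    copairing∘inclusion₂ = monadMap-unique (copairing ∘ inclusion₂ U U′) β
      λ X f → monadMap-operations M X (inj₂ f)

    copairing-unique : (γ : MonadMap (FreeMonad (U ⊕ U′)) H) →
                       γ ∘ inclusion₁ U U′ ≈ α → γ ∘ inclusion₂ U U′ ≈ β → copairing ≈ γ
    copairing-unique γ p q = monadMap-unique copairing γ λ where
        -- The hypothesis on `γ`, taken at a flat term and multiplied by `μ`, identifies the
        -- operation that `γ` induces for `inj₁ f` with that of `α`.
        X (inj₁ f) as → Eq.trans X (monadMap-operations M X (inj₁ f) as)
          (Eq.sym X (resp (H.μ.η X) (p _ (op f λ i → var (as i)))))
        X (inj₂ f) as → Eq.trans X (monadMap-operations M X (inj₂ f) as)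
          (Eq.sym X (resp (H.μ.η X) (q _ (op f λ i → var (as i)))))
      where
      module H = Monad H
      module Eq X = ExtMetricSpace.Eq (H.F.F₀ X)

  ⊕-coproduct : Coproduct (Monads (Met ℓ)) (FreeMonad U) (FreeMonad U′)
  ⊕-coproduct = record
    { object  = FreeMonad (U ⊕ U′)
    ; i₁      = inclusion₁ U U′
    ; i₂      = inclusion₂ U U′
    ; [_,_]   = copairing
    ; inject₁ = λ {_} {α} {β} → copairing∘inclusion₁ α β
    ; inject₂ = λ {_} {α} {β} → copairing∘inclusion₂ α β
    ; unique  = λ {_} {α} {β} {γ} → copairing-unique α β γ
    }

theorem5p3 : ∀ {ℓ} (S S′ : Signature ℓ) (U : Theory S) (U′ : Theory S′) →
    IsBasic U → IsBasic U′ →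
    ∃ λ (Sum : Coproduct (Monads (Met ℓ)) (FreeMonad U) (FreeMonad U′)) →
    Iso (Monads (Met ℓ)) (FreeMonad (U ⊕ U′)) (Coproduct.object Sum)
theorem5p3 {ℓ} S S′ U U′ basic basic′ = ⊕-coproduct basic basic′ , record
  -- The coproduct was built on `FreeMonad (U ⊕ U′)` itself, so identities suffice.
  { to   = id
  ; from = id
  ; isoˡ = idˡ {T} {T} {id}
  ; isoʳ = idˡ {T} {T} {id}
  }
  where
  open Category (Monads (Met ℓ)) using (id; idˡ)
  T = FreeMonad (U ⊕ U′)
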